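{- Under the full cost model, the competitive ratio of the (offline-chosen) better algorithm among MTFE, MTFO and TS is at least $1.6$: for every $c<1.6$ and every constant $b$, there exist a list and a request sequence $\sigma$ with $\min\{\mathrm{TS}(\sigma),\mathrm{MTFO}(\sigma),\mathrm{MTFE}(\sigma)\}>c\cdot\mathrm{OPT}(\sigma)+b$.
   Context: Static list update: a list of $l$ distinct items in some initial order; serving a request to the item at position $i$ (from the front) costs $i$ (full cost model); the accessed item may be moved closer to the front for free; two adjacent items may be swapped at cost $1$. $A(\sigma)$ is the total cost of algorithm $A$ and $\mathrm{OPT}(\sigma)$ the minimum cost of any offline algorithm from the same initial list. MTFO moves a requested item to the front on the 1st, 3rd, 5th, ... request to that item; MTFE on the 2nd, 4th, 6th, ... request; otherwise they leave it in place. TS (Timestamp): on a request to item $x$, if $x$ has been requested before and some item preceding $x$ has been requested at most once since the previous request to $x$, then $x$ is moved to immediately in front of the frontmost such item; otherwise nothing moves. -}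

module Defs where

open import Data.Bool.Base using (if_then_else_)
open import Data.Fin.Base using (Fin; toℕ; fromℕ)
open import Data.Fin.Properties using (any?)
open import Data.Integer.Base using (+_)
open import Data.List.Base using (List; []; _∷_; _++_; length; take; drop; takeWhile; filter)
open import Data.Nat.Base using (ℕ; zero; suc; pred; _+_; _∸_; _≤_; _<_; s≤s; z≤n)
open import Data.Nat.Divisibility using (_∣?_)
open import Data.Nat.Induction using (<-wellFounded)
open import Data.Nat.Properties using (_≟_; _≤?_; ≮⇒≥)
open import Data.Product.Base using (∃; _,_; proj₁)
open import Data.Rational.Base using (ℚ; _/_)
open import Induction.WellFounded using (Acc; acc)
open import Relation.Nullary using (Dec; yes; no; does; ¬?)

open import Data.List.Membership.DecPropositional _≟_ using (_∈?_)

Item : Set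
Item = ℕ

before : Item → List Item → List Item
before x = takeWhile (λ y → ¬? (y ≟ x))

-- Positions are counted from 1 (full cost model).
position : Item → List Item → ℕ
position x L = suc (length (before x L))

-- Moves x so that exactly j items precede it; leaves L unchanged when
-- j = length (before x L).  Only meaningful when x occurs in L.
advance : ℕ → Item → List Item → List Item
advance j x L = take j (before x L) ++ x ∷ drop j (before x L) ++ drop (position x L) L

swapAt : ℕ → List Item → List Item
swapAt zero    (x ∷ y ∷ L) = y ∷ x ∷ L
swapAt (suc i) (x ∷ L)     = x ∷ swapAt i L
swapAt _       L           = L

-- Everything an offline algorithm can do on the request sequence σ from the
-- list L: at any time a paid exchange of two adjacent items, and, on each
-- access, a free move of the accessed item to its own or an earlier position.
data Schedule : (L σ : List Item) → Set where
  done  : ∀ {L} → Schedule L []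
  swap  : ∀ {L σ} (i : Fin (pred (length L))) →
          Schedule (swapAt (toℕ i) L) σ → Schedule L σ
  serve : ∀ {L x σ} (j : Fin (position x L)) →
          Schedule (advance (toℕ j) x L) σ → Schedule L (x ∷ σ)

cost : ∀ {L σ} → Schedule L σ → ℕ
cost done                = 0
cost (swap i s)          = 1 + cost s
cost (serve {L} {x} j s) = position x L + cost s

private
  <∸⇒+< : ∀ p {m k} → m < k ∸ p → p + m < k
  <∸⇒+< zero                m<k   = m<k
  <∸⇒+< (suc p) {k = suc k} m<k∸p = s≤s (<∸⇒+< p m<k∸p)

  +<⇒<∸ : ∀ p {m k} → p + m < k → m < k ∸ p
  +<⇒<∸ zero    m<k         = m<k
  +<⇒<∸ (suc p) (s≤s p+m<k) = +<⇒<∸ p p+m<k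

cheaper? : ∀ k L σ → Dec (∃ λ (s : Schedule L σ) → cost s < k)
cheaper? zero    L σ  = no λ ()
cheaper? (suc k) L [] = yes (done , s≤s z≤n)
cheaper? (suc k) L (x ∷ σ)
  with any? (λ j → cheaper? (suc k ∸ position x L) (advance (toℕ j) x L) σ)
     | any? (λ i → cheaper? k (swapAt (toℕ i) L) (x ∷ σ))
... | yes (j , s , p) | _               = yes (serve j s , <∸⇒+< (position x L) p)
... | no _            | yes (i , s , p) = yes (swap i s , s≤s p)
... | no ¬serve       | no ¬swap        = no λ where
  (swap i s  , s≤s p) → ¬swap (i , s , p)
  (serve j s , p)     → ¬serve (j , s , +<⇒<∸ (position x L) p)

stay : ∀ L σ → Schedule L σ
stay L []      = done
stay L (x ∷ σ) = serve (fromℕ _) (stay _ σ)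

optimum : ∀ L σ → ∃ λ (s : Schedule L σ) → ∀ t → cost s ≤ cost t
optimum L σ = improve (stay L σ) (<-wellFounded _)
  where
  improve : (s : Schedule L σ) → Acc _<_ (cost s) →
            ∃ λ (s : Schedule L σ) → ∀ t → cost s ≤ cost t
  improve s (acc rs) with cheaper? (cost s) L σ
  ... | yes (t , t<s) = improve t (rs t<s)
  ... | no ¬cheaper   = s , λ t → ≮⇒≥ λ t<s → ¬cheaper (t , t<s)

OPT : (L σ : List Item) → ℕ
OPT L σ = cost (proj₁ (optimum L σ))

-- The list after a request, given the earlier requests (most recent first),
-- the list before the request, and the requested item.
Rule : Set
Rule = (past L : List Item) → Item → List Item

costFrom : Rule → (past L σ : List Item) → ℕ
costFrom A past L []      = 0
costFrom A past L (x ∷ σ) = position x L + costFrom A (x ∷ past) (A past L x) σ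

costOf : Rule → (L σ : List Item) → ℕ
costOf A = costFrom A []

count : Item → List Item → ℕ
count x σ = length (filter (_≟ x) σ)

mtfo mtfe ts : Rule

mtfo past L x = if does (2 ∣? suc (count x past)) then L else advance 0 x L

mtfe past L x = if does (2 ∣? suc (count x past)) then advance 0 x L else L

-- As past is in reverse order, before x past is what has been requested since
-- the previous request to x.
ts past L x =
  if does (x ∈? past)
  then advance (length (takeWhile (λ y → 2 ≤? count y (before x past)) (before x L))) x L
  else L

MTFO MTFE TS : (L σ : List Item) → ℕ
MTFO = costOf mtfo
MTFE = costOf mtfe
TS   = costOf ts

toℚ : ℕ → ℚ
toℚ n = + n / 1

{-# OPTIONS --safe #-}

-- Split the list into a front block X and a back block Y, and request
-- X Y X X over and over, each block always in the same order.  Counting, for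
-- each pair of items and each two rounds, the requests that have to pass the
-- other item of the pair, the algorithms TS, MTFO, MTFE and the initial list
-- left untouched pay
--    2,  4,  4, 2  on a pair from X and Y (requested as xyxx xyxx),
--   12,  9,  9, 6  on a pair from X       (requested alternately),
--    4,  3,  3, 2  on a pair from Y       (requested alternately).
-- With blocks of equal size this is 10 : 10 : 10 : 6 to leading order, so the
-- ratio 8/5 is exceeded already by small blocks: with 14 and 12 items, two
-- rounds cost 1800, 1797 and 1797 against 1122.
module Submission where

open import Defs
open import Data.Bool.Base using (true; false; if_then_else_)
open import Data.Fin.Base using (toℕ; fromℕ)
open import Data.Fin.Properties using (toℕ-fromℕ)
open import Data.Integer.Base as ℤ using (+_; -[1+_]; ∣_∣)
import Data.Integer.Properties as ℤ
open import Data.List.Base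
  using (List; []; _∷_; _++_; _ʳ++_; concat; drop; filter; length; map; replicate; reverse; take; upTo)
open import Data.List.Membership.Propositional using (_∈_)
open import Data.List.Membership.Propositional.Properties using (∈-++⁺ˡ)
open import Data.List.Properties
  using (++-identityʳ; drop-all; filter-++; length-++; map-++; reverse-++; take-all; ʳ++-defn)
open import Data.List.Relation.Unary.All as All using (All; []; _∷_; all?; tabulate)
open import Data.List.Relation.Unary.All.Properties using (concat⁺; replicate⁺)
open import Data.List.Relation.Unary.Any using (here; there)
open import Data.List.Relation.Unary.Any.Properties using (reverse⁺)
open import Data.List.Relation.Unary.Unique.Propositional using (Unique)
open import Data.List.Relation.Unary.Unique.Propositional.Properties using (upTo⁺)
open import Data.Nat.Base as ℕ using (ℕ; zero; suc; _⊓_; z≤n)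
open import Data.Nat.Divisibility using (_∣_; _∣?_; divides; ∣m∣n⇒∣m+n; ∣m+n∣m⇒∣n; _∣0)
open import Data.Nat.ListAction using (sum)
open import Data.Nat.ListAction.Properties using (sum-++)
import Data.Nat.Properties as ℕ
open import Data.Nat.Solver using (module +-*-Solver)
open import Data.Product.Base using (∃-syntax; _×_; _,_; proj₂)
open import Data.Rational.Base using (ℚ; mkℚ; _/_; _+_; _*_; _<_; _≤_; toℚᵘ; ↥_)
import Data.Rational.Properties as ℚ
open import Data.Rational.Unnormalised.Base as ℚᵘ using (mkℚᵘ; *≤*; *<*)
import Data.Rational.Unnormalised.Properties as ℚᵘ
open import Function.Bundles using (mk⇔)
open import Relation.Binary.PropositionalEquality
  using (_≡_; refl; sym; trans; cong; cong₂; subst; subst₂; module ≡-Reasoning)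
open import Relation.Nullary using (yes; no; does)
open import Relation.Nullary.Decidable using (dec-true; dec-false; does-⇔; toWitness)

open import Data.List.Membership.DecPropositional ℕ._≟_ using (_∈?_)

-- Splitting runs and forgetting old history

run : Rule → (past L σ : List Item) → List Item
run A past L []      = L
run A past L (x ∷ σ) = run A (x ∷ past) (A past L x) σ

costFrom-++ : ∀ A past L σ {τ} →
              costFrom A past L (σ ++ τ) ≡
              costFrom A past L σ ℕ.+ costFrom A (σ ʳ++ past) (run A past L σ) τ
costFrom-++ A past L []      = refl
costFrom-++ A past L (x ∷ σ) =
  trans (cong (position x L ℕ.+_) (costFrom-++ A (x ∷ past) (A past L x) σ))
        (sym (ℕ.+-assoc (position x L) _ _))

-- Histories run backwards, so `old` is what was requested before `past`. Requiring `x ∈ past` puts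
-- the previous request to `x` after `old`, and TS looks back no further than that.
Forgets : Rule → List Item → Set
Forgets A old = ∀ past L {x} → x ∈ past → A (past ++ old) L x ≡ A past L x

costFrom-forget : ∀ {A old} → Forgets A old → ∀ past L {σ} → All (_∈ past) σ →
                  costFrom A (past ++ old) L σ ≡ costFrom A past L σ
costFrom-forget         f past L []                        = refl
costFrom-forget {A} f past L (_∷_ {x} x∈past σ⊆past) rewrite f past L x∈past =
  cong (position x L ℕ.+_)
       (costFrom-forget f (x ∷ past) (A past L x) (All.map there σ⊆past))

run-forget : ∀ {A old} → Forgets A old → ∀ past L {σ} → All (_∈ past) σ →
             run A (past ++ old) L σ ≡ run A past L σ
run-forget         f past L []                        = refl
run-forget {A} f past L (_∷_ {x} x∈past σ⊆past) rewrite f past L x∈past =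
  run-forget f (x ∷ past) (A past L x) (All.map there σ⊆past)

-- Repeating one period

repeat : ℕ → List Item → List Item
repeat n σ = concat (replicate n σ)

module _ {A : Rule} {L P : List Item} {c : ℕ}
         (forgets : ∀ k → Forgets A (repeat k (reverse P)))
         (start   : run A [] L P ≡ L)
         (steady  : run A (reverse P) L P ≡ L)
         (c≤      : c ℕ.≤ costFrom A (reverse P) L P) where

  private
    P⊆reverse : All (_∈ reverse P) P
    P⊆reverse = tabulate reverse⁺

    costFrom-repeat : ∀ k n → n ℕ.* c ℕ.≤
                      costFrom A (repeat (suc k) (reverse P)) L (repeat n P)
    costFrom-repeat k zero    = z≤n
    costFrom-repeat k (suc n)
      rewrite costFrom-++ A (repeat (suc k) (reverse P)) L P {repeat n P}
            | costFrom-forget (forgets k) (reverse P) L P⊆reverse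
            | run-forget (forgets k) (reverse P) L P⊆reverse
            | steady
            -- Reversing `P` onto the history prepends one more `reverse P`, so the induction
            -- continues with `suc k`.
            | ʳ++-defn P {repeat (suc k) (reverse P)}
      = ℕ.+-mono-≤ c≤ (costFrom-repeat (suc k) n)

  -- The first period fills the history, so that every later request falls under `Forgets`. TS
  -- treats first requests specially, hence `start` beside `steady`. The cost of that period is only
  -- bounded below by zero, which leaves `n` of the `suc n` periods.
  costOf-repeat : ∀ n → n ℕ.* c ℕ.≤ costOf A L (repeat (suc n) P)
  costOf-repeat n
    rewrite costFrom-++ A [] L P {repeat n P}
          | start
    = ℕ.m≤n⇒m≤o+n (costOf A L P)
        (subst (λ past → n ℕ.* c ℕ.≤ costFrom A past L (repeat n P))
               (++-identityʳ (reverse P)) (costFrom-repeat 0 n))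

-- What the three algorithms forget

count-++ : ∀ x xs ys → count x (xs ++ ys) ≡ count x xs ℕ.+ count x ys
count-++ x xs ys = trans (cong length (filter-++ (ℕ._≟ x) xs ys)) (length-++ (filter (ℕ._≟ x) xs))

-- MTFO and MTFE consult the history only through the parity of a count, so a history of this kind
-- is invisible to them.
EvenCounts : List Item → Set
EvenCounts σ = ∀ x → 2 ∣ count x σ

evenCounts-double : ∀ σ → EvenCounts (σ ++ σ)
evenCounts-double σ x = divides (count x σ) (begin
  count x (σ ++ σ)          ≡⟨ count-++ x σ σ ⟩
  count x σ ℕ.+ count x σ   ≡⟨ cong (count x σ ℕ.+_) (ℕ.+-identityʳ _) ⟨
  2 ℕ.* count x σ           ≡⟨ ℕ.*-comm 2 (count x σ) ⟩
  count x σ ℕ.* 2           ∎)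
  where open ≡-Reasoning

evenCounts-repeat : ∀ k {σ} → EvenCounts σ → EvenCounts (repeat k σ)
evenCounts-repeat zero        even x = 2 ∣0
evenCounts-repeat (suc k) {σ} even x
  rewrite count-++ x σ (repeat k σ) = ∣m∣n⇒∣m+n (even x) (evenCounts-repeat k even x)

parity-forget : ∀ {old} → EvenCounts old → ∀ past x →
                does (2 ∣? suc (count x (past ++ old))) ≡ does (2 ∣? suc (count x past))
parity-forget {old} even past x rewrite count-++ x past old =
  does-⇔ (mk⇔ (λ 2∣ → ∣m+n∣m⇒∣n (subst (2 ∣_) (ℕ.+-comm _ (count x old)) 2∣) (even x))
              (λ 2∣ → ∣m∣n⇒∣m+n 2∣ (even x)))
         (2 ∣? suc (count x past ℕ.+ count x old)) (2 ∣? suc (count x past))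

mtfo-forgets : ∀ {old} → EvenCounts old → Forgets mtfo old
mtfo-forgets even past L {x} _ =
  cong (λ p → if p then L else advance 0 x L) (parity-forget even past x)

mtfe-forgets : ∀ {old} → EvenCounts old → Forgets mtfe old
mtfe-forgets even past L {x} _ =
  cong (λ p → if p then advance 0 x L else L) (parity-forget even past x)

before-++ : ∀ {x past} → x ∈ past → ∀ old → before x (past ++ old) ≡ before x past
before-++ {x} (here refl) old rewrite dec-true (x ℕ.≟ x) refl = refl
before-++ {x} {y ∷ _} (there x∈past) old with does (y ℕ.≟ x)
... | true  = refl
... | false = cong (y ∷_) (before-++ x∈past old)

-- When the previous request to `x` lies in `past`, neither the membership test nor `before x`
-- reaches `old`.
ts-forgets : ∀ {old} → Forgets ts old
ts-forgets {old} past L {x} x∈past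
  rewrite dec-true (x ∈? (past ++ old)) (∈-++⁺ˡ x∈past)
        | dec-true (x ∈? past) x∈past
        | before-++ x∈past old = refl

-- The untouched list as an upper bound on OPT

before-∷-drop : ∀ {x L} → x ∈ L → before x L ++ x ∷ drop (position x L) L ≡ L
before-∷-drop {x} (here refl) rewrite dec-true (x ℕ.≟ x) refl = refl
before-∷-drop {x} {y ∷ L} (there x∈L) with y ℕ.≟ x
... | yes y≡x rewrite dec-true (y ℕ.≟ x) y≡x  = cong (_∷ L) (sym y≡x)
... | no  y≢x rewrite dec-false (y ℕ.≟ x) y≢x = cong (y ∷_) (before-∷-drop x∈L)

advance-stay : ∀ {x L} → x ∈ L → advance (toℕ (fromℕ (length (before x L)))) x L ≡ L
advance-stay {x} {L} x∈L
  rewrite toℕ-fromℕ (length (before x L))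
        | take-all _ (before x L) ℕ.≤-refl
        | drop-all _ (before x L) ℕ.≤-refl = before-∷-drop x∈L

staticCost : (L σ : List Item) → ℕ
staticCost L σ = sum (map (λ x → position x L) σ)

cost-stay : ∀ {L σ} → All (_∈ L) σ → cost (stay L σ) ≡ staticCost L σ
cost-stay     []                    = refl
cost-stay {L} (_∷_ {x} {σ} x∈L σ⊆L) = cong (position x L ℕ.+_)
  (trans (cong (λ L′ → cost (stay L′ σ)) (advance-stay x∈L)) (cost-stay σ⊆L))

OPT≤staticCost : ∀ {L σ} → All (_∈ L) σ → OPT L σ ℕ.≤ staticCost L σ
OPT≤staticCost {L} {σ} σ⊆L =
  subst (OPT L σ ℕ.≤_) (cost-stay σ⊆L) (proj₂ (optimum L σ) (stay L σ))

staticCost-repeat : ∀ L P n → staticCost L (repeat n P) ≡ n ℕ.* staticCost L P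
staticCost-repeat L P zero    = refl
staticCost-repeat L P (suc n) = begin
  staticCost L (P ++ repeat n P)                ≡⟨ cong sum (map-++ _ P (repeat n P)) ⟩
  sum (map pos P ++ map pos (repeat n P))       ≡⟨ sum-++ (map pos P) _ ⟩
  staticCost L P ℕ.+ staticCost L (repeat n P)  ≡⟨ cong (staticCost L P ℕ.+_) (staticCost-repeat L P n) ⟩
  staticCost L P ℕ.+ n ℕ.* staticCost L P       ∎
  where
  open ≡-Reasoning
  pos = λ x → position x L

-- Clearing denominators

private
  toℚᵘ-toℚ : ∀ n → toℚᵘ (toℚ n) ℚᵘ.≃ mkℚᵘ (+ n) 0
  toℚᵘ-toℚ n = ℚ.toℚᵘ-fromℚᵘ (mkℚᵘ (+ n) 0)

-- The denominator is at least 1. This trades the additive constant for a natural number.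
≤-toℚ-∣↥∣ : ∀ b → b ≤ toℚ ∣ ↥ b ∣
≤-toℚ-∣↥∣ b@(mkℚ n d-1 _) = ℚ.toℚᵘ-cancel-≤
  (ℚᵘ.≤-respʳ-≃ (ℚᵘ.≃-sym (toℚᵘ-toℚ ∣ n ∣)) (*≤* (n≤∣n∣d n)))
  where
  n≤∣n∣d : ∀ n → n ℤ.* + 1 ℤ.≤ + ∣ n ∣ ℤ.* + suc d-1
  n≤∣n∣d (+ n)    rewrite ℤ.*-identityʳ (+ n) | sym (ℤ.pos-* n (suc d-1)) =
    ℤ.+≤+ (ℕ.m≤m*n n (suc d-1))
  n≤∣n∣d -[1+ n ] = ℤ.-≤+

-- Multiplying by 5, the only denominator other than 1, leaves a comparison of naturals.
8/5*+< : ∀ o b m → 8 ℕ.* o ℕ.+ 5 ℕ.* b ℕ.< 5 ℕ.* m → + 8 / 5 * toℚ o + toℚ b < toℚ m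
8/5*+< o b m lt = ℚ.toℚᵘ-cancel-< (begin-strict
  toℚᵘ (+ 8 / 5 * toℚ o + toℚ b)
    ≃⟨ ℚ.toℚᵘ-homo-+ (+ 8 / 5 * toℚ o) (toℚ b) ⟩
  toℚᵘ (+ 8 / 5 * toℚ o) ℚᵘ.+ toℚᵘ (toℚ b)
    ≃⟨ ℚᵘ.+-cong (ℚᵘ.≃-trans (ℚ.toℚᵘ-homo-* (+ 8 / 5) (toℚ o))
                              (ℚᵘ.*-congˡ {mkℚᵘ (+ 8) 4} (toℚᵘ-toℚ o)))
                 (toℚᵘ-toℚ b) ⟩
  mkℚᵘ (+ 8) 4 ℚᵘ.* mkℚᵘ (+ o) 0 ℚᵘ.+ mkℚᵘ (+ b) 0
    <⟨ *<* (subst₂ ℤ._<_ (sym numerator) (ℤ.pos-* m 5)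
          (ℤ.+<+ (subst (8 ℕ.* o ℕ.+ 5 ℕ.* b ℕ.<_) (ℕ.*-comm 5 m) lt))) ⟩
  mkℚᵘ (+ m) 0
    ≃⟨ toℚᵘ-toℚ m ⟨
  toℚᵘ (toℚ m) ∎)
  where
  open ℚᵘ.≤-Reasoning

  numerator : (+ 8 ℤ.* + o ℤ.* + 1 ℤ.+ + b ℤ.* + 5) ℤ.* + 1 ≡ + (8 ℕ.* o ℕ.+ 5 ℕ.* b)
  numerator = trans (ℤ.*-identityʳ _)
    (cong₂ ℤ._+_ (trans (ℤ.*-identityʳ _) (sym (ℤ.pos-* 8 o)))
                 (trans (ℤ.*-comm (+ b) (+ 5)) (sym (ℤ.pos-* 5 b))))

-- Each period gains 9 = 5q − 8p; k of these gains pay for the start-up period,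
-- which OPT is charged for but the online algorithms are not.
8p+5b<5q : ∀ {p q k n b} → 8 ℕ.* p ℕ.+ 9 ≡ 5 ℕ.* q → 8 ℕ.* p ℕ.< k ℕ.* 9 → k ℕ.+ b ℕ.≤ n →
           8 ℕ.* (suc n ℕ.* p) ℕ.+ 5 ℕ.* b ℕ.< 5 ℕ.* (n ℕ.* q)
8p+5b<5q {p} {q} {k} {n} {b} 8p+9≡5q 8p<9k k+b≤n = begin-strict
  8 ℕ.* (suc n ℕ.* p) ℕ.+ 5 ℕ.* b
    ≡⟨ solve 3 (λ n p b → con 8 :* (p :+ n :* p) :+ con 5 :* b
                       := n :* (con 8 :* p) :+ (con 8 :* p :+ b :* con 5)) refl n p b ⟩
  n ℕ.* (8 ℕ.* p) ℕ.+ (8 ℕ.* p ℕ.+ b ℕ.* 5)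
    <⟨ ℕ.+-monoʳ-< (n ℕ.* (8 ℕ.* p)) (ℕ.+-mono-<-≤ 8p<9k (ℕ.*-monoʳ-≤ b (ℕ.m≤m+n 5 4))) ⟩
  n ℕ.* (8 ℕ.* p) ℕ.+ (k ℕ.* 9 ℕ.+ b ℕ.* 9)
    ≡⟨ cong (n ℕ.* (8 ℕ.* p) ℕ.+_) (ℕ.*-distribʳ-+ 9 k b) ⟨
  n ℕ.* (8 ℕ.* p) ℕ.+ (k ℕ.+ b) ℕ.* 9
    ≤⟨ ℕ.+-monoʳ-≤ (n ℕ.* (8 ℕ.* p)) (ℕ.*-monoˡ-≤ 9 k+b≤n) ⟩
  n ℕ.* (8 ℕ.* p) ℕ.+ n ℕ.* 9
    ≡⟨ ℕ.*-distribˡ-+ n (8 ℕ.* p) 9 ⟨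
  n ℕ.* (8 ℕ.* p ℕ.+ 9)
    ≡⟨ cong (n ℕ.*_) 8p+9≡5q ⟩
  n ℕ.* (5 ℕ.* q)
    ≡⟨ solve 2 (λ n q → n :* (con 5 :* q) := con 5 :* (n :* q)) refl n q ⟩
  5 ℕ.* (n ℕ.* q) ∎
  where
  open ℕ.≤-Reasoning
  open +-*-Solver

affine<toℚ : ∀ {c b o m} → c < + 8 / 5 → 8 ℕ.* o ℕ.+ 5 ℕ.* ∣ ↥ b ∣ ℕ.< 5 ℕ.* m →
             c * toℚ o + b < toℚ m
affine<toℚ {c} {b} {o} {m} c<8/5 8o+5b<5m = begin-strict
  -- Not strict, since `toℚ o` may be zero and `b` may equal its bound; the next step is the strict
  -- one.
  c * toℚ o + b                 ≤⟨ ℚ.+-mono-≤ (ℚ.*-monoʳ-≤-nonNeg (toℚ o) (ℚ.<⇒≤ c<8/5))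
                                              (≤-toℚ-∣↥∣ b) ⟩
  + 8 / 5 * toℚ o + toℚ ∣ ↥ b ∣ <⟨ 8/5*+< o ∣ ↥ b ∣ m 8o+5b<5m ⟩
  toℚ m                         ∎
  where
  open ℚ.≤-Reasoning
  instance _ = ℚ.normalize-nonNeg o 1

-- From one period to the ratio

Periodic : (L P : List Item) → Rule → ℕ → Set
Periodic L P A c = run A [] L P ≡ L × run A (reverse P) L P ≡ L ×
                   c ℕ.≤ costFrom A (reverse P) L P

module _ {L P : List Item} where

  private
    EvenHistory : Set
    EvenHistory = ∀ k → EvenCounts (repeat k (reverse P))

  TS-repeat : ∀ {c} → Periodic L P ts c → ∀ n → n ℕ.* c ℕ.≤ TS L (repeat (suc n) P)
  TS-repeat (start , steady , c≤) =
    costOf-repeat {ts} {L} {P} (λ _ → ts-forgets) start steady c≤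

  MTFO-repeat : ∀ {c} → EvenHistory → Periodic L P mtfo c →
                ∀ n → n ℕ.* c ℕ.≤ MTFO L (repeat (suc n) P)
  MTFO-repeat even (start , steady , c≤) =
    costOf-repeat {mtfo} {L} {P} (λ k → mtfo-forgets (even k)) start steady c≤

  MTFE-repeat : ∀ {c} → EvenHistory → Periodic L P mtfe c →
                ∀ n → n ℕ.* c ℕ.≤ MTFE L (repeat (suc n) P)
  MTFE-repeat even (start , steady , c≤) =
    costOf-repeat {mtfe} {L} {P} (λ k → mtfe-forgets (even k)) start steady c≤

  OPT-repeat : ∀ {c} → All (_∈ L) P → staticCost L P ≡ c →
               ∀ n → OPT L (repeat n P) ℕ.≤ n ℕ.* c
  OPT-repeat P⊆L refl n =
    subst (OPT L (repeat n P) ℕ.≤_) (staticCost-repeat L P n)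
          (OPT≤staticCost (concat⁺ (replicate⁺ n P⊆L)))

  -- OPT pays at most `p` for each of the `suc n` periods, every algorithm at least `q` for each but
  -- the first.
  repeat-exceeds : ∀ {p q k} → Unique L → All (_∈ L) P → EvenHistory → staticCost L P ≡ p →
                   Periodic L P ts q → Periodic L P mtfo q → Periodic L P mtfe q →
                   8 ℕ.* p ℕ.+ 9 ≡ 5 ℕ.* q → 8 ℕ.* p ℕ.< k ℕ.* 9 →
                   ∀ c b → c < + 8 / 5 →
                   ∃[ L ] ∃[ σ ] (Unique L × All (_∈ L) σ ×
                   c * toℚ (OPT L σ) + b < toℚ (TS L σ ⊓ MTFO L σ ⊓ MTFE L σ))
  repeat-exceeds {p} {q} {k} unique P⊆L even opt ts mtfo mtfe 8p+9≡5q 8p<9k c b c<8/5 =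
    L , σ , unique , concat⁺ (replicate⁺ (suc n) P⊆L) ,
    affine<toℚ {c} {b} {OPT L σ} {TS L σ ⊓ MTFO L σ ⊓ MTFE L σ} c<8/5 (begin-strict
      8 ℕ.* OPT L σ ℕ.+ 5 ℕ.* ∣ ↥ b ∣
        ≤⟨ ℕ.+-monoˡ-≤ _ (ℕ.*-monoʳ-≤ 8 (OPT-repeat P⊆L opt (suc n))) ⟩
      8 ℕ.* (suc n ℕ.* p) ℕ.+ 5 ℕ.* ∣ ↥ b ∣
        <⟨ 8p+5b<5q {p} {q} {k} 8p+9≡5q 8p<9k ℕ.≤-refl ⟩
      5 ℕ.* (n ℕ.* q)
        ≤⟨ ℕ.*-monoʳ-≤ 5 (ℕ.⊓-glb (ℕ.⊓-glb (TS-repeat ts n) (MTFO-repeat even mtfo n))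
                                  (MTFE-repeat even mtfe n)) ⟩
      5 ℕ.* (TS L σ ⊓ MTFO L σ ⊓ MTFE L σ) ∎)
    where
    open ℕ.≤-Reasoning
    -- The gains of `k` periods outweigh the first one; each further period gains 9, which covers
    -- the 5 due for one unit of `∣ ↥ b ∣`.
    n = k ℕ.+ ∣ ↥ b ∣
    σ = repeat (suc n) P

-- The instance with blocks of 14 and 12 items

items X Y round period : List Item
items  = upTo 26
-- In this order both blocks are back in their initial order after a period.
X      = reverse (take 14 items)
Y      = reverse (drop 14 items)
round  = X ++ Y ++ X ++ X
period = round ++ round

period⊆items : All (_∈ items) period
period⊆items = toWitness {a? = all? (_∈? items) period} _

-- A round requests each item three times or once, an odd number; this is why a period consists of
-- two rounds. Its reversal is `reverse round` twice.
history-even : ∀ k → EvenCounts (repeat k (reverse period))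
history-even k = evenCounts-repeat k
  (subst EvenCounts (sym (reverse-++ round round)) (evenCounts-double (reverse round)))

static-period : staticCost items period ≡ 1122
static-period = refl

-- TS pays 1800; the weaker bound gives all three algorithms the same `q`.
ts-period : Periodic items period ts 1797
ts-period = refl , refl , toWitness {a? = 1797 ℕ.≤? costFrom ts (reverse period) items period} _

mtfo-period : Periodic items period mtfo 1797
mtfo-period = refl , refl , toWitness {a? = 1797 ℕ.≤? costFrom mtfo (reverse period) items period} _

mtfe-period : Periodic items period mtfe 1797
mtfe-period = refl , refl , toWitness {a? = 1797 ℕ.≤? costFrom mtfe (reverse period) items period} _

theorem5 : ∀ (c b : ℚ) → c < + 8 / 5 →
    ∃[ L ] ∃[ σ ] (Unique L × All (_∈ L) σ ×
    c * toℚ (OPT L σ) + b < toℚ (TS L σ ⊓ MTFO L σ ⊓ MTFE L σ))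
theorem5 = repeat-exceeds {items} {period} {1122} {1797} {998}
  (upTo⁺ 26) period⊆items history-even static-period ts-period mtfo-period mtfe-period
  -- Here 8 · 1122 + 9 = 8985 = 5 · 1797, and 998 is the least `k` with 8 · 1122 = 8976 below 9 ·
  -- `k`.
  refl (toWitness {a? = 8976 ℕ.<? 8982} _)
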